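{- Let $n, p, s$ be non-negative integers with $1 \le 2p+s \le n$. Let $M_n$ be the graph with vertex set $V(M_n)=\{a_1,\dots,a_n,b_1,\dots,b_n\}$ and edge set $\{a_1b_1, a_2b_2,\dots,a_nb_n\}$. Let $\mathcal{H}^{(p,s)}(n)$ be the family of all subsets $H\subseteq V(M_n)$ with $|H|=2p+s$ such that $H$ spans exactly $p$ edges of $M_n$ (equivalently, $H$ consists of the two endpoints of each of $p$ edges together with $s$ further vertices, no two of which are endpoints of the same edge). Then $\mathcal{H}^{(p,s)}(n)$ has the Erd\H{o}s--Ko--Rado property: there exists a vertex $x\in V(M_n)$ such that every intersecting subfamily $\mathcal{F}\subseteq \mathcal{H}^{(p,s)}(n)$ satisfies $|\mathcal{F}|\le |\{H\in\mathcal{H}^{(p,s)}(n) : x\in H\}|$.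
   Context: A family of sets is intersecting if any two of its members have nonempty intersection. -}

module Defs where

open import Data.Nat using (ℕ; zero; suc; _+_; _*_; _≟_)
open import Data.Bool using (Bool; true; false)
open import Data.Fin using (Fin)
open import Data.Fin.Subset using (Subset; _∈_; _∩_; ∣_∣)
open import Data.Fin.Subset.Properties using (_∈?_)
open import Data.Vec using (Vec; []; _∷_)
open import Data.List using (List; []; _∷_; map; concatMap; filter; length)
open import Data.List.Membership.Propositional renaming (_∈_ to _∈L_)
open import Data.Product using (_×_; _,_; Σ; ∃)
open import Relation.Binary.PropositionalEquality using (_≡_)
open import Relation.Nullary using (Dec)
open import Relation.Nullary.Decidable using (_×-dec_)

-- Vertices of M_n: (i , true) is a_i and (i , false) is b_i  (i : Fin n).
-- The edges of M_n are exactly {(i,true),(i,false)} for i : Fin n.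
Vtx : ℕ → Set
Vtx n = Fin n × Bool

-- A subset H of V(M_n), represented by its characteristic data:
-- (A , B) with a_i ∈ H iff i ∈ A and b_i ∈ H iff i ∈ B.
-- (This is a bijective encoding of subsets of V(M_n).)
VSet : ℕ → Set
VSet n = Subset n × Subset n

infix 4 _∈V_
_∈V_ : ∀ {n} → Vtx n → VSet n → Set
(i , true)  ∈V (A , B) = i ∈ A
(i , false) ∈V (A , B) = i ∈ B

_∈V?_ : ∀ {n} (x : Vtx n) (H : VSet n) → Dec (x ∈V H)
(i , true)  ∈V? (A , B) = i ∈? A
(i , false) ∈V? (A , B) = i ∈? B

size : ∀ {n} → VSet n → ℕ
size (A , B) = ∣ A ∣ + ∣ B ∣

spannedEdges : ∀ {n} → VSet n → ℕ
spannedEdges (A , B) = ∣ A ∩ B ∣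

InH : ∀ {n} (p s : ℕ) → VSet n → Set
InH p s H = size H ≡ 2 * p + s × spannedEdges H ≡ p

InH? : ∀ {n} (p s : ℕ) (H : VSet n) → Dec (InH p s H)
InH? p s H = (size H ≟ 2 * p + s) ×-dec (spannedEdges H ≟ p)

allSubsets : (n : ℕ) → List (Subset n)
allSubsets zero    = [] ∷ []
allSubsets (suc n) = concatMap (λ S → (true ∷ S) ∷ (false ∷ S) ∷ []) (allSubsets n)

allVSets : (n : ℕ) → List (VSet n)
allVSets n = concatMap (λ A → map (λ B → (A , B)) (allSubsets n)) (allSubsets n)

starSize : (n p s : ℕ) → Vtx n → ℕ
starSize n p s x = length (filter (λ H → InH? p s H ×-dec (x ∈V? H)) (allVSets n))

Intersecting : ∀ {n} → List (VSet n) → Set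
Intersecting F = ∀ {G H} → G ∈L F → H ∈L F → ∃ λ x → x ∈V G × x ∈V H

{-# OPTIONS --safe #-}
module Submission where

-- Katona's cycle method. Place the 2n vertices on ℤ/2n, the ends of the i-th edge at 2i and 2i + s
-- (two vertices share a place when s is even). A window of k = 2p + s consecutive places then contains
-- exactly k vertices, and both ends of exactly p edges: those for which 2i is among the first 2p places.
-- So all 2n windows lie in H^(p,s)(n). As k ≤ n, an intersecting family contains at most k of them,
-- while each star contains exactly k. Averaging over the symmetry group of M_n, which acts
-- transitively on H^(p,s)(n), compares the family with the star.

open import Defs
open import Data.Bool using (Bool; true; false; if_then_else_; _∧_; not)
import Data.Bool.Properties as Bool
open import Data.Empty using (⊥)
open import Data.Fin using (Fin; zero; suc; toℕ; punchOut)
import Data.Fin.Properties as Fin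
open import Data.Fin.Subset using (Subset)
open import Data.List using (List; []; _∷_; _++_; length; map; filter; applyUpTo; upTo; allFin; tabulate; cartesianProduct)
import Data.List.Properties as List
open import Data.List.Membership.Propositional using (lose) renaming (_∈_ to _∈L_)
open import Data.List.Membership.Propositional.Properties using (∈-map⁺; ∈-concatMap⁺; ∈-filter⁺)
import Data.List.Relation.Unary.All as All
open import Data.List.Relation.Unary.All using (All; []; _∷_)
open import Data.List.Relation.Unary.All.Properties using (all-filter)
open import Data.List.Relation.Unary.AllPairs using (_∷_)
open import Data.List.Relation.Unary.Any using (here; there)
open import Data.List.Relation.Unary.Unique.Propositional using (Unique)
open import Data.Nat using (ℕ; zero; suc; _+_; _*_; _≤_; _<_; z≤n; s≤s; NonZero; _≟_; _<?_; >-nonZero)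
open import Data.Nat.DivMod using (_%_; %-distribˡ-+; m<n⇒m%n≡m; [m+n]%n≡m%n)
open import Data.Nat.ListAction using (sum)
open import Data.Nat.ListAction.Properties using (sum-++)
open import Data.Nat.Properties hiding (_≟_; _<?_)
open import Data.Nat.Solver using (module +-*-Solver)
open import Data.Product using (Σ; ∃; _×_; _,_; proj₁; proj₂)
import Data.Product.Properties as Product
open import Data.Sum using (_⊎_; inj₁; inj₂)
open import Data.Vec using (Vec; []; _∷_; lookup; insertAt; removeAt; zip; unzip)
import Data.Vec as Vec
import Data.Vec.Properties as Vec
open import Data.Vec.Properties
  using (insertAt-lookup; insertAt-punchIn; lookup∘tabulate; tabulate-cong; lookup-zip; zip∘unzip; unzip∘zip; []=⇒lookup; lookup⇒[]=)
open import Function using (_∘_; id; mk⇔)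
open import Relation.Binary.PropositionalEquality
open import Relation.Nullary using (Dec; yes; no; does; ¬_; contradiction)
open import Relation.Nullary.Decidable using (_×-dec_; does-⇔; dec-true; dec-false)

private variable
  X Y : Set
  P Q : Set

-- Indicators of decidable propositions

bit : Bool → ℕ
bit b = if b then 1 else 0

𝟙 : Dec P → ℕ
𝟙 d = bit (does d)

𝟙-cong : (P → Q) → (Q → P) → (p? : Dec P) (q? : Dec Q) → 𝟙 p? ≡ 𝟙 q?
𝟙-cong f g p? q? = cong bit (does-⇔ (mk⇔ f g) p? q?)

𝟙-yes : (p? : Dec P) → P → 𝟙 p? ≡ 1
𝟙-yes p? p = cong bit (dec-true p? p)

𝟙-no : (p? : Dec P) → ¬ P → 𝟙 p? ≡ 0
𝟙-no p? ¬p = cong bit (dec-false p? ¬p)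

𝟙-× : (p? : Dec P) (q? : Dec Q) → 𝟙 (p? ×-dec q?) ≡ 𝟙 p? * 𝟙 q?
𝟙-× (yes _) (yes _) = refl
𝟙-× (yes _) (no _)  = refl
𝟙-× (no _)  _       = refl

does-true : (p? : Dec P) → does p? ≡ true → P
does-true (yes p) _ = p

𝟙-guard : ∀ {a b} (p? : Dec P) → (P → a ≡ b) → 𝟙 p? * a ≡ 𝟙 p? * b
𝟙-guard (yes p) e = cong (1 *_) (e p)
𝟙-guard (no _)  e = refl

-- Finite sums

∑ : List X → (X → ℕ) → ℕ
∑ xs f = sum (map f xs)

∑< : ℕ → (ℕ → ℕ) → ℕ
∑< m f = sum (applyUpTo f m)

∑-upTo : ∀ m (f : ℕ → ℕ) → ∑ (upTo m) f ≡ ∑< m f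
∑-upTo m f = cong sum (List.map-upTo f m)

∑-congᴬ : ∀ {f g : X → ℕ} {xs} → All (λ x → f x ≡ g x) xs → ∑ xs f ≡ ∑ xs g
∑-congᴬ []       = refl
∑-congᴬ (e ∷ es) = cong₂ _+_ e (∑-congᴬ es)

∑-cong : ∀ (xs : List X) {f g : X → ℕ} → (∀ x → f x ≡ g x) → ∑ xs f ≡ ∑ xs g
∑-cong xs e = cong sum (List.map-cong e xs)

∑-mono : ∀ (xs : List X) {f g : X → ℕ} → (∀ x → f x ≤ g x) → ∑ xs f ≤ ∑ xs g
∑-mono []       le = z≤n
∑-mono (x ∷ xs) le = +-mono-≤ (le x) (∑-mono xs le)

∑-const : ∀ (xs : List X) c → ∑ xs (λ _ → c) ≡ length xs * c
∑-const []       c = refl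
∑-const (x ∷ xs) c = cong (c +_) (∑-const xs c)

+-interchange : ∀ a b c d → (a + b) + (c + d) ≡ (a + c) + (b + d)
+-interchange = solve 4 (λ a b c d → (a :+ b) :+ (c :+ d) := (a :+ c) :+ (b :+ d)) refl
  where open +-*-Solver

∑-+ : ∀ (xs : List X) (f g : X → ℕ) → ∑ xs (λ x → f x + g x) ≡ ∑ xs f + ∑ xs g
∑-+ []       f g = refl
∑-+ (x ∷ xs) f g = trans (cong (f x + g x +_) (∑-+ xs f g)) (+-interchange (f x) (g x) _ _)

∑-*ˡ : ∀ (xs : List X) c (f : X → ℕ) → ∑ xs (λ x → c * f x) ≡ c * ∑ xs f
∑-*ˡ []       c f = sym (*-zeroʳ c)
∑-*ˡ (x ∷ xs) c f = trans (cong (c * f x +_) (∑-*ˡ xs c f)) (sym (*-distribˡ-+ c (f x) _))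

∑-*ʳ : ∀ (xs : List X) c (f : X → ℕ) → ∑ xs (λ x → f x * c) ≡ ∑ xs f * c
∑-*ʳ xs c f = trans (∑-cong xs (λ x → *-comm (f x) c)) (trans (∑-*ˡ xs c f) (*-comm c _))

∑-swap : ∀ (xs : List X) (ys : List Y) (f : X → Y → ℕ) →
         ∑ xs (λ x → ∑ ys (f x)) ≡ ∑ ys (λ y → ∑ xs (λ x → f x y))
∑-swap []       ys f = sym (trans (∑-const ys 0) (*-zeroʳ (length ys)))
∑-swap (x ∷ xs) ys f =
  trans (cong (∑ ys (f x) +_) (∑-swap xs ys f)) (sym (∑-+ ys (f x) _))

∑-× : ∀ (xs : List X) (ys : List Y) (f : X × Y → ℕ) →
      ∑ (cartesianProduct xs ys) f ≡ ∑ xs (λ x → ∑ ys (λ y → f (x , y)))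
∑-× []       ys f = refl
∑-× (x ∷ xs) ys f =
  trans (trans (cong sum (List.map-++ f (map (x ,_) ys) _)) (sum-++ (map f (map (x ,_) ys)) _))
        (cong₂ _+_ (cong sum (sym (List.map-∘ ys))) (∑-× xs ys f))

∑-∈ : ∀ {x : X} {xs} (f : X → ℕ) → x ∈L xs → f x ≤ ∑ xs f
∑-∈ f (here refl) = m≤m+n _ _
∑-∈ {xs = y ∷ _} f (there x∈) = ≤-trans (∑-∈ f x∈) (m≤n+m _ (f y))

∑<-cong : ∀ m {f g : ℕ → ℕ} → (∀ i → i < m → f i ≡ g i) → ∑< m f ≡ ∑< m g
∑<-cong zero    e = refl
∑<-cong (suc m) e = cong₂ _+_ (e 0 (s≤s z≤n)) (∑<-cong m (λ i i<m → e (suc i) (s≤s i<m)))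

∑<-+ : ∀ m (f g : ℕ → ℕ) → ∑< m (λ i → f i + g i) ≡ ∑< m f + ∑< m g
∑<-+ zero    f g = refl
∑<-+ (suc m) f g = trans (cong (f 0 + g 0 +_) (∑<-+ m (f ∘ suc) (g ∘ suc))) (+-interchange (f 0) (g 0) _ _)

∑<-zero : ∀ m {f : ℕ → ℕ} → (∀ i → i < m → f i ≡ 0) → ∑< m f ≡ 0
∑<-zero zero    e = refl
∑<-zero (suc m) e = cong₂ _+_ (e 0 (s≤s z≤n)) (∑<-zero m (λ i i<m → e (suc i) (s≤s i<m)))

∑<-bound : ∀ m {f : ℕ → ℕ} → (∀ i → i < m → f i ≤ 1) → ∑< m f ≤ m
∑<-bound zero    e = z≤n
∑<-bound (suc m) e = +-mono-≤ (e 0 (s≤s z≤n)) (∑<-bound m (λ i i<m → e (suc i) (s≤s i<m)))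

∑<-split : ∀ a b (f : ℕ → ℕ) → ∑< (a + b) f ≡ ∑< a f + ∑< b (λ i → f (a + i))
∑<-split zero    b f = refl
∑<-split (suc a) b f = trans (cong (f 0 +_) (∑<-split a b (f ∘ suc))) (sym (+-assoc (f 0) _ _))

∑<-last : ∀ m (f : ℕ → ℕ) → ∑< (suc m) f ≡ ∑< m f + f m
∑<-last zero    f = +-identityʳ (f 0)
∑<-last (suc m) f = trans (cong (f 0 +_) (∑<-last m (f ∘ suc))) (sym (+-assoc (f 0) _ _))

∑<-rotate : ∀ m (f : ℕ → ℕ) → f m ≡ f 0 → ∑< m (f ∘ suc) ≡ ∑< m f
∑<-rotate m f e = +-cancelˡ-≡ (f 0) _ _
  (trans (∑<-last m f) (trans (+-comm _ (f m)) (cong (_+ ∑< m f) e)))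

-- Moving the start of a period by one drops a value at one end and adds an equal one at the other;
-- this is `∑<-rotate`, applied `x` times.
∑<-shift : ∀ m (f : ℕ → ℕ) → (∀ x → f (x + m) ≡ f x) → ∀ x → ∑< m (λ i → f (x + i)) ≡ ∑< m f
∑<-shift m f per zero    = refl
∑<-shift m f per (suc x) = trans
  (trans (∑<-cong m (λ i _ → cong f (sym (+-suc x i))))
         (∑<-rotate m (λ i → f (x + i)) (trans (per x) (cong f (sym (+-identityʳ x))))))
  (∑<-shift m f per x)

∑<-interleave : ∀ m (f : ℕ → ℕ) → ∑< (m * 2) f ≡ ∑< m (λ i → f (i * 2)) + ∑< m (λ i → f (1 + i * 2))
∑<-interleave zero    f = refl
∑<-interleave (suc m) f =
  trans (sym (+-assoc (f 0) (f 1) _))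
  (trans (cong (f 0 + f 1 +_) (∑<-interleave m (λ i → f (2 + i))))
         (+-interchange (f 0) (f 1) _ _))

∑<-below : ∀ j m → j ≤ m → ∑< m (λ i → 𝟙 (i <? j)) ≡ j
∑<-below zero    m       _        = ∑<-zero m (λ i _ → 𝟙-no (i <? 0) λ ())
∑<-below (suc j) (suc m) (s≤s le) = cong suc
  (trans (∑<-cong m (λ i _ → 𝟙-cong ≤-pred s≤s (suc i <? suc j) (i <? j))) (∑<-below j m le))

-- Katona's lemma

∑<-zero-or-pos : ∀ m (f : ℕ → ℕ) → ∑< m f ≡ 0 ⊎ ∃ λ x → 1 ≤ f x
∑<-zero-or-pos zero    f = inj₁ refl
∑<-zero-or-pos (suc m) f with f 0 in eq | ∑<-zero-or-pos m (f ∘ suc)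
... | suc _ | _              = inj₂ (0 , subst (1 ≤_) (sym eq) (s≤s z≤n))
... | zero  | inj₁ e         = inj₁ e
... | zero  | inj₂ (x , pos) = inj₂ (suc x , pos)

-- On a cycle of length `2k + e`, no two marked points may be at a distance between `k` and `k + e`.
-- Seen from a marked point `x₀`, the `e` places from `k` on are unmarked, and the remaining `2k`
-- places pair up as `i` and `k + e + i`, at distance `k + e`, so each of the `k` pairs contributes
-- at most one. The length is written `k + (e + k)` to match this splitting.
katona : ∀ k e (χ : ℕ → ℕ) → (∀ x → χ (x + (k + (e + k))) ≡ χ x) →
         (∀ x d → k ≤ d → d ≤ k + e → χ x + χ (x + d) ≤ 1) →
         ∑< (k + (e + k)) χ ≤ k
katona k e χ per dis with ∑<-zero-or-pos (k + (e + k)) χ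
... | inj₁ z = subst (_≤ k) (sym z) z≤n
... | inj₂ (x₀ , pos) = subst (_≤ k) total (∑<-bound k pair)
  where
  χ′ : ℕ → ℕ
  χ′ i = χ (x₀ + i)

  -- `χ x₀` already uses up the bound 1 of `dis`.
  gap : ∀ i → i < e → χ′ (k + i) ≡ 0
  gap i i<e = n≤0⇒n≡0 (≤-pred (≤-trans (+-monoˡ-≤ (χ′ (k + i)) pos)
    (dis x₀ (k + i) (m≤m+n k i) (+-monoʳ-≤ k (<⇒≤ i<e)))))

  pair : ∀ i → i < k → χ′ i + χ′ (k + (e + i)) ≤ 1
  pair i _ = subst (λ y → χ′ i + χ y ≤ 1) eq (dis (x₀ + i) (k + e) (m≤m+n k e) ≤-refl)
    where
    open +-*-Solver
    eq : x₀ + i + (k + e) ≡ x₀ + (k + (e + i))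
    eq = solve 4 (λ x i k e → x :+ i :+ (k :+ e) := x :+ (k :+ (e :+ i))) refl x₀ i k e

  total : ∑< k (λ i → χ′ i + χ′ (k + (e + i))) ≡ ∑< (k + (e + k)) χ
  total = begin
    ∑< k (λ i → χ′ i + χ′ (k + (e + i)))
      ≡⟨ ∑<-+ k χ′ (λ i → χ′ (k + (e + i))) ⟩
    ∑< k χ′ + ∑< k (λ i → χ′ (k + (e + i)))
      ≡⟨ cong (λ z → ∑< k χ′ + (z + ∑< k (λ i → χ′ (k + (e + i))))) (∑<-zero e gap) ⟨
    ∑< k χ′ + (∑< e (λ i → χ′ (k + i)) + ∑< k (λ i → χ′ (k + (e + i))))
      ≡⟨ cong (∑< k χ′ +_) (∑<-split e k (λ i → χ′ (k + i))) ⟨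
    ∑< k χ′ + ∑< (e + k) (λ i → χ′ (k + i))
      ≡⟨ ∑<-split k (e + k) χ′ ⟨
    ∑< (k + (e + k)) χ′
      ≡⟨ ∑<-shift (k + (e + k)) χ per x₀ ⟩
    ∑< (k + (e + k)) χ ∎
    where open ≡-Reasoning

-- The action of permutations and flips of the edges

-- A subset of V(M_n) as the vector of its traces on the n edges.
Cell : Set
Cell = Bool × Bool

Cells : ℕ → Set
Cells n = Vec Cell n

card : Cell → ℕ
card (a , b) = bit a + bit b

full : Cell → ℕ
full (a , b) = bit (a ∧ b)

side : Bool → Cell → Bool
side true  = proj₁
side false = proj₂

flip : Bool → Cell → Cell
flip true  (a , b) = (b , a)
flip false c       = c

_≟ᶜ_ : (c d : Cell) → Dec (c ≡ d)
_≟ᶜ_ = Product.≡-dec Bool._≟_ Bool._≟_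

_≟ᵛ_ : ∀ {n} (v w : Cells n) → Dec (v ≡ w)
_≟ᵛ_ = Vec.≡-dec _≟ᶜ_

card-flip : ∀ b c → card (flip b c) ≡ card c
card-flip true  (a , b) = +-comm (bit b) (bit a)
card-flip false c       = refl

full-flip : ∀ b c → full (flip b c) ≡ full c
full-flip true  (a , b) = cong bit (Bool.∧-comm b a)
full-flip false c       = refl

wsum : ∀ {n} → (Cell → ℕ) → Cells n → ℕ
wsum f w = Vec.sum (Vec.map f w)

∑-allFin : ∀ {n} (f : Cell → ℕ) (w : Cells n) → ∑ (allFin n) (λ i → f (lookup w i)) ≡ wsum f w
∑-allFin f w = trans (cong sum (List.map-tabulate id (λ i → f (lookup w i)))) (go w)
  where
  go : ∀ {n} (w : Cells n) → sum (tabulate (λ i → f (lookup w i))) ≡ wsum f w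
  go []      = refl
  go (c ∷ w) = cong (f c +_) (go w)

+-swapˡ : ∀ a b c → a + (b + c) ≡ b + (a + c)
+-swapˡ = solve 3 (λ a b c → a :+ (b :+ c) := b :+ (a :+ c)) refl
  where open +-*-Solver

wsum-insertAt : ∀ {n} f (w : Cells n) i c → wsum f (insertAt w i c) ≡ f c + wsum f w
wsum-insertAt f w       zero    c = refl
wsum-insertAt f (d ∷ w) (suc i) c =
  trans (cong (f d +_) (wsum-insertAt f w i c)) (+-swapˡ (f d) (f c) _)

insertAt-removeAt : ∀ {n} (w : Vec X (suc n)) i → insertAt (removeAt w i) i (lookup w i) ≡ w
insertAt-removeAt (c ∷ w)     zero    = refl
insertAt-removeAt (c ∷ d ∷ w) (suc i) = cong (c ∷_) (insertAt-removeAt (d ∷ w) i)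

removeAt-insertAt : ∀ {n} (v : Vec X n) i c → removeAt (insertAt v i c) i ≡ v
removeAt-insertAt v               zero    c = refl
removeAt-insertAt (d ∷ [])        (suc zero) c = refl
removeAt-insertAt (d ∷ v@(_ ∷ _)) (suc i) c with insertAt v i c | removeAt-insertAt v i c
... | _ ∷ _ | e = cong (d ∷_) e

wsum-removeAt : ∀ {n} f (w : Cells (suc n)) i → wsum f w ≡ f (lookup w i) + wsum f (removeAt w i)
wsum-removeAt f w i = trans (cong (wsum f) (sym (insertAt-removeAt w i)))
                            (wsum-insertAt f (removeAt w i) i (lookup w i))

-- The symmetry group of M_n: a vector is permuted and flipped by successive insertions.
data G : ℕ → Set where
  ε   : G 0
  ins : ∀ {n} → Fin (suc n) × Bool × G n → G (suc n)

act : ∀ {n} → G n → Cells n → Cells n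
act ε                 []      = []
act (ins (i , b , g)) (c ∷ v) = insertAt (act g v) i (flip b c)

bools : List Bool
bools = true ∷ false ∷ []

elements : ∀ n → List (G n)
elements zero    = ε ∷ []
elements (suc n) = map ins (cartesianProduct (allFin (suc n)) (cartesianProduct bools (elements n)))

∑-elements : ∀ n (f : G (suc n) → ℕ) → ∑ (elements (suc n)) f ≡
  ∑ (allFin (suc n)) (λ i → ∑ bools (λ b → ∑ (elements n) (λ g → f (ins (i , b , g)))))
∑-elements n f = begin
  ∑ (elements (suc n)) f              ≡⟨ cong sum (List.map-∘ {g = f} {f = ins} (cartesianProduct is bgs)) ⟨
  ∑ (cartesianProduct is bgs) (f ∘ ins) ≡⟨ ∑-× is bgs (f ∘ ins) ⟩
  ∑ is (λ i → ∑ bgs (λ bg → f (ins (i , bg))))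
    ≡⟨ ∑-cong is (λ i → ∑-× bools (elements n) (λ bg → f (ins (i , bg)))) ⟩
  ∑ is (λ i → ∑ bools (λ b → ∑ (elements n) (λ g → f (ins (i , b , g))))) ∎
  where
  open ≡-Reasoning
  is  = allFin (suc n)
  bgs = cartesianProduct bools (elements n)

wsum-act : ∀ {n} f → (∀ b c → f (flip b c) ≡ f c) → ∀ (g : G n) v → wsum f (act g v) ≡ wsum f v
wsum-act f inv ε                 []      = refl
wsum-act f inv (ins (i , b , g)) (c ∷ v) =
  trans (wsum-insertAt f (act g v) i (flip b c)) (cong₂ _+_ (inv b c) (wsum-act f inv g v))

cnt : ∀ {n} → ℕ → Cells n → ℕ
cnt j = wsum (λ c → 𝟙 (j ≟ card c))

-- The number of flips fixing a cell with j vertices.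
stab : ℕ → ℕ
stab 1 = 1
stab _ = 2

-- Two cells lie in one flip orbit exactly when they have equally many vertices. Both flips fix an
-- empty or a full cell, while a single vertex is sent to each end by exactly one flip.
∑-flip : ∀ c d → ∑ bools (λ b → 𝟙 (flip b c ≟ᶜ d)) ≡ 𝟙 (card c ≟ card d) * stab (card c)
∑-flip (true  , true)  (true  , true)  = refl
∑-flip (true  , true)  (true  , false) = refl
∑-flip (true  , true)  (false , true)  = refl
∑-flip (true  , true)  (false , false) = refl
∑-flip (true  , false) (true  , true)  = refl
∑-flip (true  , false) (true  , false) = refl
∑-flip (true  , false) (false , true)  = refl
∑-flip (true  , false) (false , false) = refl
∑-flip (false , true)  (true  , true)  = refl
∑-flip (false , true)  (true  , false) = refl
∑-flip (false , true)  (false , true)  = refl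
∑-flip (false , true)  (false , false) = refl
∑-flip (false , false) (true  , true)  = refl
∑-flip (false , false) (true  , false) = refl
∑-flip (false , false) (false , true)  = refl
∑-flip (false , false) (false , false) = refl

-- The order of the stabiliser of v.
weight : ∀ {n} → Cells n → ℕ
weight []      = 1
weight (c ∷ v) = cnt (card c) (c ∷ v) * (stab (card c) * weight v)

weight-pos : ∀ {n} (v : Cells n) → 1 ≤ weight v
weight-pos []      = ≤-refl
weight-pos (c ∷ v) = *-mono-≤ cnt-pos (*-mono-≤ (stab-pos (card c)) (weight-pos v))
  where
  cnt-pos : 1 ≤ cnt (card c) (c ∷ v)
  cnt-pos = ≤-trans (≤-reflexive (sym (𝟙-yes (card c ≟ card c) refl))) (m≤m+n _ _)
  stab-pos : ∀ j → 1 ≤ stab j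
  stab-pos 0             = s≤s z≤n
  stab-pos 1             = s≤s z≤n
  stab-pos (suc (suc _)) = s≤s z≤n

-- Insertion at a fixed place is a bijection from pairs of a cell and a shorter vector. The factored
-- indicator separates the choice of a flip from that of the smaller group element.
insertAt-≟ : ∀ {n} (v : Cells n) i c (w : Cells (suc n)) →
  𝟙 (insertAt v i c ≟ᵛ w) ≡ 𝟙 (c ≟ᶜ lookup w i) * 𝟙 (v ≟ᵛ removeAt w i)
insertAt-≟ v i c w = trans
  (𝟙-cong (λ { refl → sym (insertAt-lookup v i c) , sym (removeAt-insertAt v i c) })
          (λ { (refl , refl) → insertAt-removeAt w i })
          (insertAt v i c ≟ᵛ w) ((c ≟ᶜ lookup w i) ×-dec (v ≟ᵛ removeAt w i)))
  (𝟙-× (c ≟ᶜ lookup w i) (v ≟ᵛ removeAt w i))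

-- Induction on the head `c`: it may land on any of the `cnt (card c) w` cells of its own size, by
-- `stab (card c)` flips each, and the tail is then carried to the rest of `w` in `weight v` ways.
-- That the count is the same for every such `w`, and positive by `weight-pos`, is the transitivity
-- that the averaging rests on.
orbit-count : ∀ {n} (v w : Cells n) → (∀ j → cnt j v ≡ cnt j w) →
  ∑ (elements n) (λ g → 𝟙 (act g v ≟ᵛ w)) ≡ weight v
orbit-count []              []           same = refl
orbit-count {suc n} (c ∷ v) w            same = begin
  ∑ (elements (suc n)) (λ g → 𝟙 (act g (c ∷ v) ≟ᵛ w))
    ≡⟨ ∑-elements n (λ g → 𝟙 (act g (c ∷ v) ≟ᵛ w)) ⟩
  ∑ (allFin (suc n)) (λ i → ∑ bools (λ b → ∑ (elements n) (λ g → 𝟙 (insertAt (act g v) i (flip b c) ≟ᵛ w))))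
    ≡⟨ ∑-cong (allFin (suc n)) step ⟩
  ∑ (allFin (suc n)) (λ i → meets i * r)
    ≡⟨ ∑-*ʳ (allFin (suc n)) r meets ⟩
  ∑ (allFin (suc n)) meets * r
    ≡⟨ cong (_* r) (trans (∑-allFin (λ d → 𝟙 (card c ≟ card d)) w) (sym (same (card c)))) ⟩
  weight (c ∷ v) ∎
  where
  open ≡-Reasoning
  r : ℕ
  r = stab (card c) * weight v

  meets : Fin (suc n) → ℕ
  meets i = 𝟙 (card c ≟ card (lookup w i))

  rest : Fin (suc n) → ℕ
  rest i = ∑ (elements n) (λ g → 𝟙 (act g v ≟ᵛ removeAt w i))

  -- Deleting cells of equal size from both vectors keeps all the counts `cnt j` equal, so the
  -- induction hypothesis applies.
  rest-weight : ∀ i → card c ≡ card (lookup w i) → rest i ≡ weight v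
  rest-weight i e = orbit-count v (removeAt w i) λ j →
    +-cancelˡ-≡ (𝟙 (j ≟ card c)) _ _
      (trans (same j) (trans (wsum-removeAt _ w i) (cong (λ z → 𝟙 (j ≟ z) + cnt j (removeAt w i)) (sym e))))

  step : ∀ i → ∑ bools (λ b → ∑ (elements n) (λ g → 𝟙 (insertAt (act g v) i (flip b c) ≟ᵛ w))) ≡ meets i * r
  step i = begin
    ∑ bools (λ b → ∑ (elements n) (λ g → 𝟙 (insertAt (act g v) i (flip b c) ≟ᵛ w)))
      ≡⟨ ∑-cong bools (λ b → trans (∑-cong (elements n) (λ g → insertAt-≟ (act g v) i (flip b c) w))
                                   (∑-*ˡ (elements n) (𝟙 (flip b c ≟ᶜ lookup w i)) (λ g → 𝟙 (act g v ≟ᵛ removeAt w i)))) ⟩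
    ∑ bools (λ b → 𝟙 (flip b c ≟ᶜ lookup w i) * rest i)
      ≡⟨ ∑-*ʳ bools (rest i) (λ b → 𝟙 (flip b c ≟ᶜ lookup w i)) ⟩
    ∑ bools (λ b → 𝟙 (flip b c ≟ᶜ lookup w i)) * rest i
      ≡⟨ cong (_* rest i) (∑-flip c (lookup w i)) ⟩
    meets i * stab (card c) * rest i
      ≡⟨ *-assoc (meets i) (stab (card c)) (rest i) ⟩
    meets i * (stab (card c) * rest i)
      -- `rest-weight` is available only where the sizes agree; elsewhere both sides vanish.
      ≡⟨ 𝟙-guard (card c ≟ card (lookup w i)) (λ e → cong (stab (card c) *_) (rest-weight i e)) ⟩
    meets i * r ∎

at : ∀ {n} → Vtx n → Cells n → Bool
at (i , β) w = side β (lookup w i)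

-- The vertex `y` is the preimage of `x` under `g`. It is the same for all `v`, so a common vertex
-- of two images pulls back to a common vertex of the original sets.
act-at : ∀ {n} (g : G n) (x : Vtx n) → ∃ λ y → ∀ v → at x (act g v) ≡ at y v
act-at (ins (i , b , g)) (j , β) with i Fin.≟ j
-- The edge inserted at `i` comes from the head, with its ends exchanged when `b` is `true`; any
-- other edge comes from the tail, by recursion.
... | yes refl = (zero , turn b β) , λ { (c ∷ v) → trans (cong (side β) (insertAt-lookup (act g v) i (flip b c))) (side-flip b β c) }
  where
  turn : Bool → Bool → Bool
  turn true  β = not β
  turn false β = β
  side-flip : ∀ b β c → side β (flip b c) ≡ side (turn b β) c
  side-flip true  true  c = refl
  side-flip true  false c = refl
  side-flip false β     c = refl
... | no i≢j with act-at g (punchOut i≢j , β)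
... | (j′ , γ) , e = (suc j′ , γ) , λ { (c ∷ v) → trans (cong (side β) (look c v)) (e v) }
  where
  look : ∀ c v → lookup (insertAt (act g v) i (flip b c)) j ≡ lookup (act g v) (punchOut i≢j)
  look c v = trans (cong (lookup (insertAt (act g v) i (flip b c))) (sym (Fin.punchIn-punchOut i≢j)))
                   (insertAt-punchIn (act g v) i (flip b c) (punchOut i≢j))

-- Passage between subsets of `V(M_n)` and vectors of cells

cells : ∀ {n} → VSet n → Cells n
cells (A , B) = zip A B

cells-injective : ∀ {n} {H K : VSet n} → cells H ≡ cells K → H ≡ K
cells-injective {H = A , B} {K = C , D} e =
  trans (sym (unzip∘zip A B)) (trans (cong unzip e) (unzip∘zip C D))

size-cells : ∀ {n} (H : VSet n) → size H ≡ wsum card (cells H)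
size-cells ([] , [])               = refl
size-cells (true  ∷ A , true  ∷ B) = cong suc (trans (+-suc _ _) (cong suc (size-cells (A , B))))
size-cells (true  ∷ A , false ∷ B) = cong suc (size-cells (A , B))
size-cells (false ∷ A , true  ∷ B) = trans (+-suc _ _) (cong suc (size-cells (A , B)))
size-cells (false ∷ A , false ∷ B) = size-cells (A , B)

spannedEdges-cells : ∀ {n} (H : VSet n) → spannedEdges H ≡ wsum full (cells H)
spannedEdges-cells ([] , [])               = refl
spannedEdges-cells (true  ∷ A , true  ∷ B) = cong suc (spannedEdges-cells (A , B))
spannedEdges-cells (true  ∷ A , false ∷ B) = spannedEdges-cells (A , B)
spannedEdges-cells (false ∷ A , true  ∷ B) = spannedEdges-cells (A , B)
spannedEdges-cells (false ∷ A , false ∷ B) = spannedEdges-cells (A , B)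

at-cells : ∀ {n} (x : Vtx n) (H : VSet n) → at x (cells H) ≡ true → x ∈V H
at-cells (i , true)  (A , B) e = lookup⇒[]= i A (trans (cong proj₁ (sym (lookup-zip i A B))) e)
at-cells (i , false) (A , B) e = lookup⇒[]= i B (trans (cong proj₂ (sym (lookup-zip i A B))) e)

cells-at : ∀ {n} (x : Vtx n) (H : VSet n) → x ∈V H → at x (cells H) ≡ true
cells-at (i , true)  (A , B) e = trans (cong proj₁ (lookup-zip i A B)) ([]=⇒lookup e)
cells-at (i , false) (A , B) e = trans (cong proj₂ (lookup-zip i A B)) ([]=⇒lookup e)

∈-allSubsets : ∀ {n} (A : Subset n) → A ∈L allSubsets n
∈-allSubsets []      = here refl
∈-allSubsets (b ∷ A) = ∈-concatMap⁺ _ (lose (∈-allSubsets A) (choose b))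
  where
  choose : ∀ b → (b ∷ A) ∈L ((true ∷ A) ∷ (false ∷ A) ∷ [])
  choose true  = here refl
  choose false = there (here refl)

∈-allVSets : ∀ {n} (H : VSet n) → H ∈L allVSets n
∈-allVSets (A , B) = ∈-concatMap⁺ _ (lose (∈-allSubsets A) (∈-map⁺ (A ,_) (∈-allSubsets B)))

-- Size and spanned edges determine the orbit

cnt-0 : ∀ {n} (w : Cells n) → cnt 0 w + (cnt 1 w + wsum full w) ≡ n
cnt-0 []                  = refl
cnt-0 ((true  , true)  ∷ w) = trans (cong (cnt 0 w +_) (+-suc (cnt 1 w) _)) (trans (+-suc (cnt 0 w) _) (cong suc (cnt-0 w)))
cnt-0 ((true  , false) ∷ w) = trans (+-suc (cnt 0 w) _) (cong suc (cnt-0 w))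
cnt-0 ((false , true)  ∷ w) = trans (+-suc (cnt 0 w) _) (cong suc (cnt-0 w))
cnt-0 ((false , false) ∷ w) = cong suc (cnt-0 w)

cnt-1 : ∀ {n} (w : Cells n) → cnt 1 w + wsum full w * 2 ≡ wsum card w
cnt-1 []                    = refl
cnt-1 ((true  , true)  ∷ w) = trans (+-suc (cnt 1 w) _) (cong suc (trans (+-suc (cnt 1 w) _) (cong suc (cnt-1 w))))
cnt-1 ((true  , false) ∷ w) = cong suc (cnt-1 w)
cnt-1 ((false , true)  ∷ w) = cong suc (cnt-1 w)
cnt-1 ((false , false) ∷ w) = cnt-1 w

cnt-2 : ∀ {n} (w : Cells n) → cnt 2 w ≡ wsum full w
cnt-2 []                    = refl
cnt-2 ((true  , true)  ∷ w) = cong suc (cnt-2 w)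
cnt-2 ((true  , false) ∷ w) = cnt-2 w
cnt-2 ((false , true)  ∷ w) = cnt-2 w
cnt-2 ((false , false) ∷ w) = cnt-2 w

cnt-3 : ∀ {n} j (w : Cells n) → cnt (3 + j) w ≡ 0
cnt-3 j []                    = refl
cnt-3 j ((true  , true)  ∷ w) = cnt-3 j w
cnt-3 j ((true  , false) ∷ w) = cnt-3 j w
cnt-3 j ((false , true)  ∷ w) = cnt-3 j w
cnt-3 j ((false , false) ∷ w) = cnt-3 j w

-- Full cells are the spanned edges, the cells with one vertex account for the remaining vertices,
-- and the empty cells for the remaining edges. Through `orbit-count`, all members of H^(p,s) lie in
-- a single orbit.
cnt-type : ∀ {n} (v w : Cells n) → wsum card v ≡ wsum card w → wsum full v ≡ wsum full w →
           ∀ j → cnt j v ≡ cnt j w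
cnt-type v w ec ef = λ where
    0                   → +-cancelʳ-≡ _ _ _ (trans (cnt-0 v) (trans (sym (cnt-0 w)) (cong (cnt 0 w +_) (sym (cong₂ _+_ one ef)))))
    1                   → one
    2                   → trans (cnt-2 v) (trans ef (sym (cnt-2 w)))
    (suc (suc (suc j))) → trans (cnt-3 j v) (sym (cnt-3 j w))
  where
  one : cnt 1 v ≡ cnt 1 w
  one = +-cancelʳ-≡ _ _ _
    (trans (cnt-1 v) (trans ec (trans (sym (cnt-1 w)) (cong (λ z → cnt 1 w + z * 2) (sym ef)))))

wsum-tabulate : ∀ f n (c : ℕ → Cell) → wsum f (Vec.tabulate {n = n} (c ∘ toℕ)) ≡ ∑< n (f ∘ c)
wsum-tabulate f zero    c = refl
wsum-tabulate f (suc n) c = cong (f (c 0) +_) (wsum-tabulate f n (c ∘ suc))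

-- Remainders and parity

%-+-small : ∀ y d m .{{_ : NonZero m}} → y % m + d < m → (y + d) % m ≡ y % m + d
%-+-small y d m lt = begin
  (y + d) % m           ≡⟨ %-distribˡ-+ y d m ⟩
  (y % m + d % m) % m   ≡⟨ cong (λ z → (y % m + z) % m) (m<n⇒m%n≡m (≤-<-trans (m≤n+m d (y % m)) lt)) ⟩
  (y % m + d) % m       ≡⟨ m<n⇒m%n≡m lt ⟩
  y % m + d             ∎
  where open ≡-Reasoning

parity : ∀ s → ∃ λ t → s ≡ t * 2 ⊎ s ≡ 1 + t * 2
parity zero    = 0 , inj₁ refl
parity (suc s) with parity s
... | t , inj₁ e = t , inj₂ (cong suc e)
... | t , inj₂ e = suc t , inj₁ (cong suc e)

*2≡+ : ∀ n → n * 2 ≡ n + n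
*2≡+ n = trans (*-comm n 2) (cong (n +_) (+-identityʳ n))

-- Windows of the cycle

module Windows (n p s : ℕ) (k≤n : 2 * p + s ≤ n) .{{_ : NonZero (n * 2)}} where

  k m : ℕ
  k = 2 * p + s
  m = n * 2

  k+k≤m : k + k ≤ m
  k+k≤m = subst (k + k ≤_) (sym (*2≡+ n)) (+-mono-≤ k≤n k≤n)

  k≤m : k ≤ m
  k≤m = ≤-trans (m≤m+n k k) k+k≤m

  in? : ∀ j y → Dec (y % m < j)
  in? j y = y % m <? j

  χ : ℕ → ℕ → ℕ
  χ j y = 𝟙 (in? j y)

  χ-periodic : ∀ j y → χ j (y + m) ≡ χ j y
  χ-periodic j y = cong (λ z → 𝟙 (z <? j)) ([m+n]%n≡m%n y m)

  χ-small : ∀ j i → i < m → χ j i ≡ 𝟙 (i <? j)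
  χ-small j i i<m = cong (λ z → 𝟙 (z <? j)) (m<n⇒m%n≡m i<m)

  ∑-χ : ∀ j → j ≤ m → ∑< m (χ j) ≡ j
  ∑-χ j j≤m = trans (∑<-cong m (χ-small j)) (∑<-below j m j≤m)

  -- In the window `x`, the number of vertices `a_i` is `evens k x` and that of vertices `b_i` is
  -- `evens k (s + x)`; the number of spanned edges will be `evens (p * 2) x`.
  evens : ℕ → ℕ → ℕ
  evens j x = ∑< n (λ i → χ j (x + i * 2))

  evens-step : ∀ j x → evens j (2 + x) ≡ evens j x
  evens-step j x = trans
    (∑<-cong n (λ i _ → cong (χ j) (sym (trans (+-suc x _) (cong suc (+-suc x _))))))
    (∑<-rotate n (λ i → χ j (x + i * 2)) (trans (χ-periodic j x) (cong (χ j) (sym (+-identityʳ x)))))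

  evens-+2* : ∀ j x t → evens j (t * 2 + x) ≡ evens j x
  evens-+2* j x zero    = refl
  evens-+2* j x (suc t) = trans (evens-step j (t * 2 + x)) (evens-+2* j x t)

  -- The places of both parities together run once round the cycle, which has `j` places below `j`.
  evens-pair : ∀ j x → j ≤ m → evens j x + evens j (1 + x) ≡ j
  evens-pair j x j≤m = begin
    evens j x + evens j (1 + x)
      ≡⟨ cong (evens j x +_) (∑<-cong n (λ i _ → cong (χ j) (sym (+-suc x _)))) ⟩
    evens j x + ∑< n (λ i → χ j (x + (1 + i * 2)))
      ≡⟨ ∑<-interleave n (λ i → χ j (x + i)) ⟨
    ∑< m (λ i → χ j (x + i))
      ≡⟨ ∑<-shift m (χ j) (χ-periodic j) x ⟩
    ∑< m (χ j)
      ≡⟨ ∑-χ j j≤m ⟩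
    j ∎
    where open ≡-Reasoning

  -- An arc of even length has as many places of either parity. Offset 0 is counted directly, offset
  -- 1 is the complement by `evens-pair`, and `evens-step` reduces the others to these two.
  evens-even : ∀ t → t ≤ n → ∀ x → evens (t * 2) x ≡ t
  evens-even t t≤n zero = trans
    (∑<-cong n (λ i i<n → trans (χ-small (t * 2) (i * 2) (*-monoˡ-< 2 i<n))
      (𝟙-cong (*-cancelʳ-< 2 i t) (*-monoˡ-< 2) (i * 2 <? t * 2) (i <? t))))
    (∑<-below t n t≤n)
  evens-even t t≤n (suc zero) = +-cancelˡ-≡ t _ _
    (trans (cong (_+ evens (t * 2) 1) (sym (evens-even t t≤n 0)))
           (trans (evens-pair (t * 2) 0 (*-monoˡ-≤ 2 t≤n)) (*2≡+ t)))
  evens-even t t≤n (suc (suc x)) = trans (evens-step (t * 2) x) (evens-even t t≤n x)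

  -- The vertices are placed on the cycle ℤ/2n so that the ends of edge i are at 2i and 2i + s.
  position : Vtx n → ℕ
  position (i , true)  = toℕ i * 2
  position (i , false) = s + toℕ i * 2

  cell : ℕ → ℕ → Cell
  cell x i = does (in? k (x + i * 2)) , does (in? k (x + (s + i * 2)))

  -- The window of length k starting at −x.
  window : ℕ → Cells n
  window x = Vec.tabulate (cell x ∘ toℕ)

  at-window : ∀ v x → at v (window x) ≡ does (in? k (x + position v))
  at-window (i , true)  x = cong proj₁ (lookup∘tabulate (cell x ∘ toℕ) i)
  at-window (i , false) x = cong proj₂ (lookup∘tabulate (cell x ∘ toℕ) i)

  window-periodic : ∀ x → window (x + m) ≡ window x
  window-periodic x = tabulate-cong λ i →
    cong₂ _,_ (shift (toℕ i * 2)) (shift (s + toℕ i * 2))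
    where
    open +-*-Solver
    shift : ∀ y → does (in? k (x + m + y)) ≡ does (in? k (x + y))
    shift y = cong (λ z → does (z <? k)) (trans
      (cong (_% m) (solve 3 (λ x m y → x :+ m :+ y := x :+ y :+ m) refl x m y))
      ([m+n]%n≡m%n (x + y) m))

  window-size : ∀ x → wsum card (window x) ≡ k
  window-size x = trans (wsum-tabulate card n (cell x))
    (trans (∑<-+ n (λ i → χ k (x + i * 2)) (λ i → χ k (x + (s + i * 2))))
    (trans (cong (evens k x +_) (∑<-cong n (λ i _ → cong (χ k)
      (trans (sym (+-assoc x s _)) (cong (_+ i * 2) (+-comm x s))))))
    total))
    where
    total : evens k x + evens k (s + x) ≡ k
    total with parity s
    -- For even `s`, `k` is even as well, and the `a`-ends and the `b`-ends each fill half of the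
    -- window.
    ... | t , inj₁ e = trans (cong₂ _+_ (half x) (half (s + x))) (trans (sym (*2≡+ (p + t))) (sym k-even))
      where
      k-even : k ≡ (p + t) * 2
      k-even = trans (cong₂ _+_ (*-comm 2 p) e) (sym (*-distribʳ-+ 2 p t))
      half : ∀ x → evens k x ≡ p + t
      half x = trans (cong (λ j → evens j x) k-even) (evens-even (p + t)
        (≤-trans (m≤m*n (p + t) 2) (≤-trans (≤-reflexive (sym k-even)) k≤n)) x)
    -- For odd `s`, the `b`-ends occupy the parity opposite to the `a`-ends, so each place carries
    -- exactly one vertex.
    ... | t , inj₂ e = trans (cong (evens k x +_) (trans (cong (λ z → evens k (z + x)) e)
        (trans (cong (evens k) (sym (+-suc (t * 2) x))) (evens-+2* k (1 + x) t))))
      (evens-pair k x k≤m)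

  window-full : ∀ x → wsum full (window x) ≡ p
  window-full x = trans (wsum-tabulate full n (cell x))
    (trans (∑<-cong n (λ i _ → trans (cong (λ z → bit (does (in? k (x + i * 2)) ∧ does (in? k z))) (rearrange i)) (both (x + i * 2))))
           (evens-even p (≤-trans (m≤m+n p _) (≤-trans (m≤m+n (2 * p) s) k≤n)) x))
    where
    open +-*-Solver
    rearrange : ∀ i → x + (s + i * 2) ≡ x + i * 2 + s
    rearrange i = solve 3 (λ x s y → x :+ (s :+ y) := x :+ y :+ s) refl x s (i * 2)

    -- From a place below `k`, a step of `s` does not pass the end of the cycle, since `s ≤ k` and
    -- `k + k ≤ m`. So the second end is below `k = 2p + s` exactly when the first is below `2p`.
    small : ∀ y → y % m < k → (y + s) % m ≡ y % m + s
    small y lt = %-+-small y s m (<-≤-trans (+-monoˡ-< s lt) (≤-trans (+-monoʳ-≤ k (m≤n+m s (2 * p))) k+k≤m))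

    both : ∀ y → bit (does (in? k y) ∧ does (in? k (y + s))) ≡ χ (p * 2) y
    both y = 𝟙-cong
      (λ { (y< , y+s<) → subst (y % m <_) (*-comm 2 p) (+-cancelʳ-< s _ _ (subst (_< k) (small y y<) y+s<)) })
      (λ y< → let y+s< = +-monoˡ-< s (subst (y % m <_) (*-comm p 2) y<)
                  y<k  = ≤-<-trans (m≤m+n (y % m) s) y+s<
              in y<k , subst (_< k) (sym (small y y<k)) y+s<)
      (in? k y ×-dec in? k (y + s)) (in? (p * 2) y)

  -- With `v` fixed and `x` varying, `x + position v` runs once round the cycle.
  window-count : ∀ v → ∑< m (λ x → bit (at v (window x))) ≡ k
  window-count v = begin
    ∑< m (λ x → bit (at v (window x)))  ≡⟨ ∑<-cong m (λ x _ → trans (cong bit (at-window v x)) (cong (χ k) (+-comm x _))) ⟩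
    ∑< m (λ x → χ k (position v + x))   ≡⟨ ∑<-shift m (χ k) (χ-periodic k) (position v) ⟩
    ∑< m (χ k)                          ≡⟨ ∑-χ k k≤m ⟩
    k                                   ∎
    where open ≡-Reasoning

  -- A remainder below `k` increased by `d` stays below `m` because `d + k ≤ m`, so it does not
  -- wrap, and it is at least `k` because `k ≤ d`. The hypotheses are contradictory, hence the
  -- arbitrary conclusion `X`.
  window-disjoint : ∀ v x d → k ≤ d → d + k ≤ m → at v (window x) ≡ true → at v (window (x + d)) ≡ true → X
  window-disjoint v x d k≤d d+k≤m e e′ = contradiction (≤-<-trans k≤d (≤-<-trans (m≤n+m d _) hi)) (n≮n k)
    where
    member : ∀ x → at v (window x) ≡ true → (x + position v) % m < k
    member x e = does-true (in? k (x + position v)) (trans (sym (at-window v x)) e)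
    open +-*-Solver
    y = x + position v
    y< : y % m < k
    y< = member x e
    hi : y % m + d < k
    hi = subst (_< k)
      (trans (cong (_% m) (solve 3 (λ x d q → x :+ d :+ q := x :+ q :+ d) refl x d (position v)))
             (%-+-small y d m (<-≤-trans (+-monoˡ-< d y<) (≤-trans (≤-reflexive (+-comm k d)) d+k≤m))))
      (member (x + d) e′)

-- Double counting

module Averaging (n p s : ℕ) (1≤k : 1 ≤ 2 * p + s) (k≤n : 2 * p + s ≤ n) .{{_ : NonZero (n * 2)}} where

  open Windows n p s k≤n

  -- For a duplicate-free `F` this is the indicator of membership; as a sum over `F` it can be
  -- interchanged with the sums over symmetries and windows.
  hits : List (VSet n) → Cells n → ℕ
  hits F w = ∑ F (λ H → 𝟙 (w ≟ᵛ cells H))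

  hits-∈ : ∀ F w → 1 ≤ hits F w → ∃ λ H → H ∈L F × w ≡ cells H
  hits-∈ (H ∷ F) w pos with w ≟ᵛ cells H
  ... | yes e = H , here refl , e
  ... | no _ with hits-∈ F w pos
  ...   | K , K∈F , e = K , there K∈F , e

  hits-∉ : ∀ F w → (∀ {H} → H ∈L F → w ≢ cells H) → hits F w ≡ 0
  hits-∉ F w w∉ with hits F w in eq
  ... | zero  = refl
  ... | suc _ with hits-∈ F w (subst (1 ≤_) (sym eq) (s≤s z≤n))
  ...   | _ , H∈F , e = contradiction e (w∉ H∈F)

  hits-≤1 : ∀ F w → Unique F → hits F w ≤ 1
  hits-≤1 []      w _ = z≤n
  hits-≤1 (H ∷ F) w (H∉F ∷ uF) with w ≟ᵛ cells H
  ... | yes e = s≤s (≤-reflexive (hits-∉ F w λ K∈F e′ →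
                  All.lookup H∉F K∈F (cells-injective (trans (sym e) e′))))
  ... | no _  = hits-≤1 F w uF

  +-≤1 : ∀ {a b} → a ≤ 1 → b ≤ 1 → (1 ≤ a → 1 ≤ b → ⊥) → a + b ≤ 1
  +-≤1 z≤n       b≤1       _ = b≤1
  +-≤1 (s≤s z≤n) z≤n       _ = ≤-refl
  +-≤1 (s≤s z≤n) (s≤s z≤n) f = contradiction (s≤s z≤n) (f (s≤s z≤n))

  -- `katona` applies to the image of the cycle under `g`, with `e = m - 2k`: windows shifted by a
  -- distance from `k` to `k + e` are disjoint, so `F` contains at most one of the two images.
  intersecting-windows : ∀ F → Unique F → Intersecting F → ∀ (g : G n) →
    ∑< m (λ x → hits F (act g (window x))) ≤ k
  intersecting-windows F uF int g with m≤n⇒∃[o]m+o≡n k+k≤m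
  ... | e , k+k+e≡m = subst (λ z → ∑< z hit ≤ k) (sym m≡)
      (katona k e hit (λ x → cong (hits F ∘ act g) (trans (cong (λ z → window (x + z)) (sym m≡)) (window-periodic x))) apart)
    where
    shot : ℕ → Cells n
    shot x = act g (window x)

    hit : ℕ → ℕ
    hit x = hits F (shot x)

    m≡ : m ≡ k + (e + k)
    m≡ = trans (sym k+k+e≡m) (trans (+-assoc k k e) (cong (k +_) (+-comm k e)))

    apart : ∀ x d → k ≤ d → d ≤ k + e → hit x + hit (x + d) ≤ 1
    apart x d k≤d d≤k+e = +-≤1 (hits-≤1 F (shot x) uF) (hits-≤1 F (shot (x + d)) uF) clash
      where
      d+k≤m : d + k ≤ m
      d+k≤m = ≤-trans (+-monoˡ-≤ k d≤k+e) (≤-reflexive (trans (+-assoc k e k) (sym m≡)))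

      clash : 1 ≤ hit x → 1 ≤ hit (x + d) → ⊥
      clash pos pos′ with hits-∈ F (shot x) pos | hits-∈ F (shot (x + d)) pos′
      ... | H , H∈F , eH | K , K∈F , eK with int H∈F K∈F
      -- The common vertex of the two members, pulled back along `g`, lies in both original windows.
      ...   | v , v∈H , v∈K with act-at g v
      ...     | u , pull = window-disjoint u x d k≤d d+k≤m (meet x eH v∈H) (meet (x + d) eK v∈K)
        where
        meet : ∀ y {L} → act g (window y) ≡ cells L → v ∈V L → at u (window y) ≡ true
        meet y {L} e v∈L = trans (sym (pull (window y))) (trans (cong (at v) e) (cells-at v L v∈L))

  -- The number of pairs `(g , x)` for which `g` carries window `x` to a given member of H^(p,s); by
  -- `window-orbit` it is the same for all members.
  total-weight : ℕ
  total-weight = ∑ (upTo m) (λ x → weight (window x))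

  total-weight-pos : 1 ≤ total-weight
  total-weight-pos = ≤-trans (*-mono-≤ 1≤m (≤-refl {1})) (≤-trans
    (≤-reflexive (sym (trans (∑-const (upTo m) 1) (cong (_* 1) (List.length-upTo m)))))
    (∑-mono (upTo m) (λ x → weight-pos (window x))))
    where
    1≤m : 1 ≤ m
    1≤m = ≤-trans 1≤k k≤m

  window-orbit : ∀ {H : VSet n} → InH p s H → ∀ x →
    ∑ (elements n) (λ g → 𝟙 (act g (window x) ≟ᵛ cells H)) ≡ weight (window x)
  window-orbit {H} (sz , sp) x = orbit-count (window x) (cells H) (cnt-type (window x) (cells H)
    (trans (window-size x) (trans (sym sz) (size-cells H)))
    (trans (window-full x) (trans (sym sp) (spannedEdges-cells H))))

  total-hits : ∀ F → All (InH p s) F →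
    ∑ (elements n) (λ g → ∑ (upTo m) (λ x → hits F (act g (window x)))) ≡ length F * total-weight
  total-hits F inF = begin
    ∑ gs (λ g → ∑ xs (λ x → ∑ F (λ H → hit g x H)))
      ≡⟨ ∑-swap gs xs (λ g x → ∑ F (λ H → hit g x H)) ⟩
    ∑ xs (λ x → ∑ gs (λ g → ∑ F (λ H → hit g x H)))
      ≡⟨ ∑-cong xs (λ x → ∑-swap gs F (λ g H → hit g x H)) ⟩
    ∑ xs (λ x → ∑ F (λ H → ∑ gs (λ g → hit g x H)))
      ≡⟨ ∑-cong xs (λ x → ∑-congᴬ (All.map (λ H∈ → window-orbit H∈ x) inF)) ⟩
    ∑ xs (λ x → ∑ F (λ H → weight (window x)))
      ≡⟨ ∑-swap xs F (λ x _ → weight (window x)) ⟩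
    ∑ F (λ _ → total-weight)
      ≡⟨ ∑-const F total-weight ⟩
    length F * total-weight ∎
    where
    open ≡-Reasoning
    gs = elements n
    xs = upTo m
    hit : G n → ℕ → VSet n → ℕ
    hit g x H = 𝟙 (act g (window x) ≟ᵛ cells H)

  star : Vtx n → List (VSet n)
  star v = filter (λ H → InH? p s H ×-dec (v ∈V? H)) (allVSets n)

  star-InH : ∀ v → All (InH p s) (star v)
  star-InH v = All.map proj₁ (all-filter (λ H → InH? p s H ×-dec (v ∈V? H)) (allVSets n))

  -- Symmetries preserve the size and the number of spanned edges, so the image of a window lies in
  -- H^(p,s), and in the star as soon as it contains `v`.
  star-hit : ∀ v (g : G n) x → bit (at v (act g (window x))) ≤ hits (star v) (act g (window x))
  star-hit v g x with at v (act g (window x)) in v∈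
  ... | false = z≤n
  ... | true  = ≤-trans (≤-reflexive (sym (𝟙-yes (w ≟ᵛ cells H) (sym cells-H))))
                        (∑-∈ (λ K → 𝟙 (w ≟ᵛ cells K)) (∈-filter⁺ (λ K → InH? p s K ×-dec (v ∈V? K)) (∈-allVSets H)
                          ((size-H , spans-H) , at-cells v H (trans (cong (at v) cells-H) v∈))))
    where
    w = act g (window x)
    H : VSet n
    H = unzip w
    cells-H : cells H ≡ w
    cells-H = zip∘unzip w
    size-H : size H ≡ k
    size-H = trans (size-cells H) (trans (cong (wsum card) cells-H) (trans (wsum-act card card-flip g (window x)) (window-size x)))
    spans-H : spannedEdges H ≡ p
    spans-H = trans (spannedEdges-cells H) (trans (cong (wsum full) cells-H) (trans (wsum-act full full-flip g (window x)) (window-full x)))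

  star-windows : ∀ v (g : G n) → k ≤ ∑ (upTo m) (λ x → hits (star v) (act g (window x)))
  star-windows v g with act-at g v
  ... | u , pull = begin
    k                                                     ≡⟨ window-count u ⟨
    ∑< m (λ x → bit (at u (window x)))                    ≡⟨ ∑-upTo m (λ x → bit (at u (window x))) ⟨
    ∑ (upTo m) (λ x → bit (at u (window x)))              ≡⟨ ∑-cong (upTo m) (λ x → cong bit (pull (window x))) ⟨
    ∑ (upTo m) (λ x → bit (at v (act g (window x))))      ≤⟨ ∑-mono (upTo m) (star-hit v g) ⟩
    ∑ (upTo m) (λ x → hits (star v) (act g (window x)))   ∎
    where open ≤-Reasoning

  -- After multiplication by `total-weight`, both sizes become sums over the symmetries `g`. For
  -- each `g` the family contributes at most `k` and the star at least `k`; the positive factor then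
  -- cancels.
  bound : ∀ v F → Unique F → All (InH p s) F → Intersecting F → length F ≤ starSize n p s v
  bound v F uF inF int = *-cancelʳ-≤ _ _ total-weight {{>-nonZero total-weight-pos}} (begin
    length F * total-weight
      ≡⟨ total-hits F inF ⟨
    ∑ (elements n) (λ g → ∑ (upTo m) (λ x → hits F (act g (window x))))
      ≤⟨ ∑-mono (elements n) (λ g → ≤-trans
           (≤-reflexive (∑-upTo m (λ x → hits F (act g (window x))))) (intersecting-windows F uF int g)) ⟩
    ∑ (elements n) (λ _ → k)
      ≤⟨ ∑-mono (elements n) (star-windows v) ⟩
    ∑ (elements n) (λ g → ∑ (upTo m) (λ x → hits (star v) (act g (window x))))
      ≡⟨ total-hits (star v) (star-InH v) ⟩
    starSize n p s v * total-weight ∎)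
    where open ≤-Reasoning

theorem2p1 : (n p s : ℕ) → 1 ≤ 2 * p + s → 2 * p + s ≤ n →
    Σ (Vtx n) λ x → (F : List (VSet n)) → Unique F → All (InH p s) F →
    Intersecting F → length F ≤ starSize n p s x
theorem2p1 zero    p s 1≤k k≤n = contradiction (≤-trans 1≤k k≤n) λ ()
-- The vertex `a_1` is an arbitrary choice, as `bound` holds at every vertex.
theorem2p1 (suc n) p s 1≤k k≤n = (zero , true) , Averaging.bound (suc n) p s 1≤k k≤n (zero , true)
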